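{- Let $n$ be a prime, let $\alpha$ be a primitive element of $\mathbb{F}_{2^n}$, identify $\mathbb{F}_2^n$ with $\mathbb{F}_{2^n}$ as $\mathbb{F}_2$-vector spaces, and let $k\ge 2$. If there exist $\frac{2^n-2}{(2^k-1)(2^k-2)n}$ pairwise disjoint coset complete $k$-dimensional subspaces of $\mathbb{F}_2^n$, then there exists a Steiner structure $\mathbb{S}_2[2,k,n]$.
   Context: For $s\in\mathbb{Z}_{2^n-1}$, the cyclotomic coset of $s$ is $C_s=\{s\cdot 2^i \bmod (2^n-1): 0\le i\le n-1\}$, and $\rho(s)$ denotes the smallest element of $C_s$ (its coset representative). For a $k$-dimensional subspace $X=\{0,\alpha^{i_1},\dots,\alpha^{i_{2^k-1}}\}$ of $\mathbb{F}_2^n$ (exponents in $\mathbb{Z}_{2^n-1}$), its coset difference set is $\rho(\Delta(X))=\{\rho(i_r-i_s): 1\le r,s\le 2^k-1,\ r\ne s\}$. $X$ is coset complete if $|\rho(\Delta(X))|=(2^k-1)(2^k-2)$; two coset complete subspaces $X,Y$ are disjoint coset complete if $\rho(\Delta(X))\cap\rho(\Delta(Y))=\varnothing$. A Steiner structure $\mathbb{S}_2[2,k,n]$ is a set of $k$-dimensional subspaces of $\mathbb{F}_2^n$ such that each $2$-dimensional subspace of $\mathbb{F}_2^n$ is contained in exactly one of them. -}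

module Defs where

open import Algebra.Bundles using (CommutativeRing)
open import Data.Bool.Base using (Bool; true; false; _xor_; _∧_; if_then_else_)
open import Data.Fin.Base using (Fin; toℕ)
import Data.Fin.Properties as Fin
open import Data.List.Base using (List; length; map; upTo)
open import Data.List.Membership.Propositional using () renaming (_∈_ to _∈ˡ_)
open import Data.List.Relation.Unary.Unique.Propositional using (Unique)
import Data.List.Extrema as Extrema
open import Data.Nat.Base using (ℕ; _+_; _*_; _∸_; _^_; NonZero; >-nonZero; >-nonZero⁻¹; s≤s; z≤n)
open import Data.Nat.DivMod using (_mod_)
open import Data.Nat.Properties using (m<n⇒0<n∸m; ^-monoʳ-<)
open import Data.Product.Base using (_×_; ∃; ∃-syntax)
open import Data.Product using (∃!)
open import Data.Vec.Base as Vec using (Vec; replicate; zipWith)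
open import Data.Vec.Relation.Unary.All using (All)
open import Function.Bundles using (Inverse; _⇔_)
open import Level using (Level; _⊔_; 0ℓ)
open import Relation.Binary.PropositionalEquality using (_≡_; _≢_; setoid)
open import Relation.Nullary using (¬_)
open import Relation.Unary using (Pred; _∈_; _⊆_; _≐_; _⊥_)

private
  variable
    a c ℓ : Level
    n : ℕ

-- 𝔽₂ is (Bool, xor, ∧).
𝔽₂^ : ℕ → Set
𝔽₂^ n = Vec Bool n

𝟎 : 𝔽₂^ n
𝟎 = replicate _ false

infixl 6 _⊕_
_⊕_ : 𝔽₂^ n → 𝔽₂^ n → 𝔽₂^ n
_⊕_ = zipWith _xor_

infixr 7 _·_
_·_ : Bool → 𝔽₂^ n → 𝔽₂^ n
b · v = Vec.map (b ∧_) v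

linearCombination : ∀ {k} → Vec Bool k → Vec (𝔽₂^ n) k → 𝔽₂^ n
linearCombination bs vs = Vec.foldr′ _⊕_ 𝟎 (zipWith _·_ bs vs)

record Subspace (n : ℕ) : Set₁ where
  field
    carrier  : Pred (𝔽₂^ n) 0ℓ
    𝟎-mem    : 𝟎 ∈ carrier
    ⊕-closed : ∀ {u v} → u ∈ carrier → v ∈ carrier → (u ⊕ v) ∈ carrier
    ·-closed : ∀ b {v} → v ∈ carrier → (b · v) ∈ carrier

open Subspace public using (carrier)

infix 4 _≐ˢ_ _⊆ˢ_

_≐ˢ_ : Subspace n → Subspace n → Set
X ≐ˢ Y = carrier X ≐ carrier Y

_⊆ˢ_ : Subspace n → Subspace n → Set
X ⊆ˢ Y = carrier X ⊆ carrier Y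

record IsBasis {k : ℕ} (X : Subspace n) (vs : Vec (𝔽₂^ n) k) : Set where
  field
    members     : All (carrier X) vs
    spanning    : ∀ {v} → v ∈ carrier X → ∃[ bs ] linearCombination bs vs ≡ v
    independent : ∀ bs → linearCombination bs vs ≡ 𝟎 → bs ≡ replicate k false

HasDimension : Subspace n → ℕ → Set
HasDimension {n} X k = ∃ λ (vs : Vec (𝔽₂^ n) k) → IsBasis X vs

-- 𝕊₂[2,k,n].  A set of subspaces is a predicate invariant
-- under extensional equality of subspaces.

record SteinerStructure (k n : ℕ) : Set₁ where
  field
    blocks      : Pred (Subspace n) 0ℓ
    blocks-resp : ∀ {X Y} → X ≐ˢ Y → X ∈ blocks → Y ∈ blocks
    blocks-dim  : ∀ {X} → X ∈ blocks → HasDimension X k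
    covering    : ∀ (T : Subspace n) → HasDimension T 2 →
                  ∃! _≐ˢ_ (λ X → X ∈ blocks × T ⊆ˢ X)

-- Residues modulo 2ⁿ-1 are represented by their least non-negative representatives.

instance
  2^n∸1≢0 : .{{_ : NonZero n}} → NonZero (2 ^ n ∸ 1)
  2^n∸1≢0 {n} = >-nonZero (m<n⇒0<n∸m (^-monoʳ-< 2 (s≤s (s≤s z≤n)) (>-nonZero⁻¹ n)))

ℤ[2^_-1] : ℕ → Set
ℤ[2^ n -1] = Fin (2 ^ n ∸ 1)

infixl 6 _⊖_
_⊖_ : .{{_ : NonZero n}} → ℤ[2^ n -1] → ℤ[2^ n -1] → ℤ[2^ n -1]
_⊖_ {n} r s = (toℕ r + (2 ^ n ∸ 1 ∸ toℕ s)) mod (2 ^ n ∸ 1)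

cyclotomicCoset : .{{_ : NonZero n}} → ℤ[2^ n -1] → List ℤ[2^ n -1]
cyclotomicCoset {n} s = map (λ i → (toℕ s * 2 ^ i) mod (2 ^ n ∸ 1)) (upTo n)

-- `min` takes a default element; s itself lies in its coset (i = 0), so this
-- is the least element of the coset.
ρ : .{{_ : NonZero n}} → ℤ[2^ n -1] → ℤ[2^ n -1]
ρ {n} s = Extrema.min (Fin.≤-totalOrder (2 ^ n ∸ 1)) s (cyclotomicCoset {n} s)

HasCardinality : {A : Set a} → Pred A ℓ → ℕ → Set (a ⊔ ℓ)
HasCardinality P m = ∃[ xs ] Unique xs × length xs ≡ m × (∀ x → x ∈ˡ xs ⇔ x ∈ P)

module _ (F : CommutativeRing c ℓ) where
  private module F = CommutativeRing F
  open import Algebra.Definitions F._≈_ using (Invertible)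
  open import Algebra.Properties.Semiring.Exp F.semiring using () renaming (_^_ to _^ᶠ_)

  record IsField : Set (c ⊔ ℓ) where
    field
      1≉0        : ¬ (F.1# F.≈ F.0#)
      invertible : ∀ {x} → ¬ (x F.≈ F.0#) → Invertible F.1# F._*_ x

  HasOrder : ℕ → Set (c ⊔ ℓ)
  HasOrder q = Inverse F.setoid (setoid (Fin q))

  record IsPrimitive (α : F.Carrier) : Set (c ⊔ ℓ) where
    field
      nonzero    : ¬ (α F.≈ F.0#)
      generating : ∀ {x} → ¬ (x F.≈ F.0#) → ∃[ e ] (α ^ᶠ e) F.≈ x

  -- An 𝔽₂-linear isomorphism 𝔽₂ⁿ ≅ F, where 𝔽₂ acts on F through {0#, 1#}.
  record Identification (n : ℕ) : Set (c ⊔ ℓ) where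
    field
      inverse : Inverse (setoid (𝔽₂^ n)) F.setoid
    open Inverse inverse public using (to; from)
    field
      to-⊕ : ∀ u v → to (u ⊕ v) F.≈ (to u F.+ to v)
      to-· : ∀ b v → to (b · v) F.≈ (if b then F.1# else F.0#) F.* to v

module CosetDifferences
  {n : ℕ} .{{_ : NonZero n}} (F : CommutativeRing c ℓ)
  (φ : Identification F n) (α : CommutativeRing.Carrier F) where

  private module F = CommutativeRing F
  open import Algebra.Properties.Semiring.Exp F.semiring using () renaming (_^_ to _^ᶠ_)
  open Identification φ using (from)

  -- The exponents i₁, …, i_{2ᵏ-1} of the nonzero elements of X.
  exponents : Subspace n → Pred ℤ[2^ n -1] 0ℓ
  exponents X i = from (α ^ᶠ toℕ i) ∈ carrier X

  ρΔ : Subspace n → Pred ℤ[2^ n -1] 0ℓ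
  ρΔ X d = ∃[ r ] ∃[ s ] r ∈ exponents X × s ∈ exponents X × r ≢ s × d ≡ ρ {n} (r ⊖ s)

  CosetComplete : ℕ → Subspace n → Set
  CosetComplete k X = HasCardinality (ρΔ X) ((2 ^ k ∸ 1) * (2 ^ k ∸ 2))

  Disjoint : Subspace n → Subspace n → Set
  Disjoint X Y = ρΔ X ⊥ ρΔ Y

{-# OPTIONS --safe #-}
-- The blocks are the images of the given subspaces Xₜ under x ↦ αʲ x^(2ⁱ), 0 ≤ j < 2ⁿ-1, 0 ≤ i < n.
-- A 2-dimensional subspace spanned by a and b lies in one of them (for some j) iff a / b = α^d with
-- d ≡ 2ⁱ (r - s) for exponents r, s of Xₜ.  Since n is prime, no nonzero residue d is fixed by
-- multiplication by 2ⁱ, 0 < i < n, so the cyclotomic cosets of the elements of the sets ρ(Δ(Xₜ)) have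
-- n elements each; they are pairwise disjoint and therefore, by the choice of N, exhaust the 2ⁿ-2
-- nonzero residues.  Hence every d occurs; t, (r , s) and i are unique by disjointness, by coset
-- completeness and by the size of the coset, and j is then determined by a.

module Submission where

open import Defs
open import Algebra.Bundles using (CommutativeRing)
import Algebra.Properties.CommutativeSemiring.Exp as CommExp
import Algebra.Properties.CommutativeSemigroup as CommSemigroup
import Algebra.Properties.Semiring.Exp as Exp
open import Data.Bool.Base using (Bool; true; false)
import Data.Bool.Properties as Bool
open import Data.Fin.Base as Fin using (Fin; toℕ; zero; suc)
import Data.Fin.Properties as Fin
open import Data.List.Base as List using (List; []; _∷_; _++_; length; concatMap; filter)
import Data.List.Extrema as Extrema
open import Data.List.Membership.Propositional using (lose) renaming (_∈_ to _∈ˡ_)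
open import Data.List.Membership.Propositional.Properties
  using (∈-lookup; ∈-map⁺; ∈-map⁻; ∈-++⁺ˡ; ∈-++⁺ʳ; ∈-filter⁺; ∈-concatMap⁺; ∈-upTo⁺)
import Data.List.Membership.Setoid.Properties as Membership
open import Data.List.Properties using (length-map; length-++; filter-notAll)
import Data.List.Relation.Unary.All as All
import Data.List.Relation.Unary.Any as Any
open import Data.List.Relation.Unary.AllPairs using (_∷_)
open import Data.List.Relation.Unary.Unique.Propositional using (Unique)
open import Data.Nat.Base
  using (ℕ; zero; suc; _+_; _*_; _∸_; _^_; _≤_; _<_; _/_; _%_; z≤n; s≤s; NonZero; >-nonZero)
open import Data.Nat.Coprimality using (coprime-Bézout; prime⇒coprime)
open import Data.Nat.DivMod using (_mod_; m%n<n; m≡m%n+[m/n]*n)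
open import Data.Nat.GCD using (module Bézout)
import Data.Nat.Properties as ℕ
open import Data.Nat.Primality using (Prime; prime⇒nonZero)
open import Data.Product using (∃!)
open import Data.Product.Base using (_×_; _,_; ∃; ∃-syntax; proj₁; proj₂)
open import Data.Product.Properties using (≡-dec)
open import Data.Sum.Base using (inj₁; inj₂)
open import Data.Vec.Base as Vec using (Vec; []; _∷_; replicate)
import Data.Vec.Properties as Vec
import Data.Vec.Relation.Unary.All as VecAll
import Data.Vec.Relation.Unary.All.Properties as VecAll
open import Function.Base using (_∘_; id)
open import Function.Bundles using (Inverse; Equivalence)
open import Function.Definitions using (Injective)
open import Level using (Level; 0ℓ)
open import Relation.Binary.Definitions using (DecidableEquality; tri<; tri≈; tri>)
open import Relation.Binary.PropositionalEquality
  using (_≡_; _≢_; refl; sym; trans; cong; cong₂; subst; setoid; module ≡-Reasoning)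
import Relation.Binary.Reasoning.Setoid as SetoidReasoning
open import Relation.Nullary using (¬_; Dec; yes; no; contradiction; ¬?)
open import Relation.Nullary.Decidable using (map′)
open import Relation.Unary using (Pred; _∈_)

private
  variable
    a ℓ : Level
    A B : Set a
    k m n : ℕ

-- Finite counting

lookup-injective : {xs : List A} → Unique xs → Injective _≡_ _≡_ (List.lookup xs)
lookup-injective (x∉ ∷ u) {zero}  {zero}  eq = refl
lookup-injective (x∉ ∷ u) {zero}  {suc j} eq = contradiction eq (All.lookup x∉ (∈-lookup j))
lookup-injective (x∉ ∷ u) {suc i} {zero}  eq = contradiction (sym eq) (All.lookup x∉ (∈-lookup i))
lookup-injective (x∉ ∷ u) {suc i} {suc j} eq = cong suc (lookup-injective u eq)

enumeration : {P : Pred A ℓ} → HasCardinality P m →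
              ∃ λ (f : Fin m → A) → Injective _≡_ _≡_ f × (∀ i → f i ∈ P)
enumeration (xs , unique , refl , iff) =
  List.lookup xs , lookup-injective unique , λ i → Equivalence.to (iff _) (∈-lookup i)

-- One position of the list holds one entry, so distinct values of `f` occupy distinct positions.
injective-into-list : {f : Fin m → A} (xs : List A) → Injective _≡_ _≡_ f →
                      (∀ i → f i ∈ˡ xs) → m ≤ length xs
injective-into-list {A = A} xs inj mem =
  Fin.injective⇒≤ {f = λ i → Any.index (mem i)}
    (λ {i} {j} eq → inj (Membership.index-injective (setoid A) (mem i) (mem j) eq))

-- If `f p ≡ f q` with `p ≢ q`, then `p` can be deleted from `zs` without losing a value of `f`. The
-- `m` distinct values of `g` would then fit into a list with fewer than `m` entries.
injective-on-list : DecidableEquality A → (f : A → B) (zs : List A) {g : Fin m → B} →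
  Injective _≡_ _≡_ g → (∀ i → ∃[ z ] z ∈ˡ zs × g i ≡ f z) → length zs ≤ m →
  ∀ {p q} → p ∈ˡ zs → q ∈ˡ zs → f p ≡ f q → p ≡ q
injective-on-list _≟_ f zs {g} g-inj onto short {p} {q} p∈ q∈ fp≡fq with p ≟ q
... | yes p≡q = p≡q
... | no p≢q = contradiction
    (ℕ.≤-trans (injective-into-list (List.map f others) g-inj mem) (ℕ.≤-reflexive (length-map f others)))
    (ℕ.<⇒≱ (ℕ.<-≤-trans (filter-notAll ≢p? zs (Any.map (λ p≡z z≢p → z≢p (sym p≡z)) p∈)) short))
  where
  ≢p? = λ z → ¬? (z ≟ p)
  others = filter ≢p? zs
  mem : ∀ i → g i ∈ˡ List.map f others
  mem i with onto i
  ... | z , z∈ , gi≡fz with z ≟ p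
  ...   | yes z≡p = subst (_∈ˡ _) (sym (trans gi≡fz (trans (cong f z≡p) fp≡fq)))
                      (∈-map⁺ f (∈-filter⁺ ≢p? q∈ (p≢q ∘ sym)))
  ...   | no z≢p  = subst (_∈ˡ _) (sym gi≡fz) (∈-map⁺ f (∈-filter⁺ ≢p? z∈ z≢p))

-- A missed `d` would give `k + 2` distinct elements of `Fin m`: `z`, `d` and the values of `f`.
onto-nonzero : {z : Fin m} (f : Fin k → Fin m) → Injective _≡_ _≡_ f → (∀ i → f i ≢ z) →
               m < suc (suc k) → ∀ {d} → d ≢ z → ∃[ i ] f i ≡ d
onto-nonzero {m} {k} {z} f inj avoid small {d} d≢z with Fin.any? (λ i → f i Fin.≟ d)
... | yes hit = hit
... | no miss = contradiction (Fin.injective⇒≤ f⁺-injective) (ℕ.<⇒≱ small)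
  where
  f⁺ : Fin (suc (suc k)) → Fin m
  f⁺ zero          = z
  f⁺ (suc zero)    = d
  f⁺ (suc (suc i)) = f i

  f⁺-injective : Injective _≡_ _≡_ f⁺
  f⁺-injective {zero}        {zero}        eq = refl
  f⁺-injective {zero}        {suc zero}    eq = contradiction (sym eq) d≢z
  f⁺-injective {zero}        {suc (suc j)} eq = contradiction (sym eq) (avoid j)
  f⁺-injective {suc zero}    {zero}        eq = contradiction eq d≢z
  f⁺-injective {suc zero}    {suc zero}    eq = refl
  f⁺-injective {suc zero}    {suc (suc j)} eq = contradiction (j , sym eq) miss
  f⁺-injective {suc (suc i)} {zero}        eq = contradiction eq (avoid i)
  f⁺-injective {suc (suc i)} {suc zero}    eq = contradiction (i , eq) miss
  f⁺-injective {suc (suc i)} {suc (suc j)} eq = cong (λ i → suc (suc i)) (inj eq)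

remQuot-injective : ∀ {m} k (i j : Fin (m * k)) → Fin.remQuot {m} k i ≡ Fin.remQuot k j → i ≡ j
remQuot-injective {m} k i j eq =
  trans (sym (Fin.combine-remQuot {m} k i))
    (trans (cong (λ p → Fin.combine (proj₁ p) (proj₂ p)) eq) (Fin.combine-remQuot {m} k j))

length-concatMap-≤ : (f : A → List B) (b : ℕ) (xs : List A) → (∀ {x} → x ∈ˡ xs → length (f x) ≤ b) →
                     length (concatMap f xs) ≤ length xs * b
length-concatMap-≤ f b []       bound = z≤n
length-concatMap-≤ f b (x ∷ xs) bound =
  ℕ.≤-trans (ℕ.≤-reflexive (length-++ (f x)))
    (ℕ.+-mono-≤ (bound (Any.here refl)) (length-concatMap-≤ f b xs (bound ∘ Any.there)))

module _ (_≟_ : DecidableEquality A) where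

  private
    others : List A → A → List A
    others xs x = filter (λ y → ¬? (x ≟ y)) xs

  distinctPairs : List A → List (A × A)
  distinctPairs xs = concatMap (λ x → List.map (x ,_) (others xs x)) xs

  ∈-distinctPairs : ∀ {xs x y} → x ∈ˡ xs → y ∈ˡ xs → x ≢ y → (x , y) ∈ˡ distinctPairs xs
  ∈-distinctPairs x∈ y∈ x≢y =
    ∈-concatMap⁺ _ (lose x∈ (∈-map⁺ _ (∈-filter⁺ (λ y → ¬? (_ ≟ y)) y∈ x≢y)))

  -- Each row loses at least the entry `x` itself. In general this is only an inequality, since `xs`
  -- may contain repetitions.
  length-distinctPairs : ∀ xs → length (distinctPairs xs) ≤ length xs * (length xs ∸ 1)
  length-distinctPairs xs = length-concatMap-≤ _ _ xs λ {x} x∈ →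
    ℕ.≤-trans (ℕ.≤-reflexive (length-map (x ,_) (others xs x)))
      (ℕ.∸-monoˡ-≤ 1 (filter-notAll (λ y → ¬? (x ≟ y)) xs (Any.map (λ x≡y x≢y → x≢y x≡y) x∈)))

bitVectors : ∀ k → List (Vec Bool k)
bitVectors zero    = [] ∷ []
bitVectors (suc k) = List.map (false ∷_) (bitVectors k) ++ List.map (true ∷_) (bitVectors k)

∈-bitVectors : (bs : Vec Bool k) → bs ∈ˡ bitVectors k
∈-bitVectors []           = Any.here refl
∈-bitVectors (false ∷ bs) = ∈-++⁺ˡ (∈-map⁺ (false ∷_) (∈-bitVectors bs))
∈-bitVectors (true ∷ bs)  = ∈-++⁺ʳ _ (∈-map⁺ (true ∷_) (∈-bitVectors bs))

length-bitVectors : ∀ k → length (bitVectors k) ≡ 2 ^ k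
length-bitVectors zero    = refl
length-bitVectors (suc k) = begin
  length (bitVectors (suc k))                       ≡⟨ length-++ (List.map (false ∷_) (bitVectors k)) ⟩
  length (List.map (false ∷_) (bitVectors k)) + length (List.map (true ∷_) (bitVectors k))
    ≡⟨ cong₂ _+_ (length-map _ (bitVectors k)) (length-map _ (bitVectors k)) ⟩
  length (bitVectors k) + length (bitVectors k)     ≡⟨ cong₂ _+_ (length-bitVectors k) (trans (length-bitVectors k) (sym (ℕ.+-identityʳ _))) ⟩
  2 ^ suc k                                         ∎
  where open ≡-Reasoning

_≟ᵇ_ : DecidableEquality (Vec Bool k)
_≟ᵇ_ = Vec.≡-dec Bool._≟_

nonzeroBitVectors : ∀ k → List (Vec Bool k)
nonzeroBitVectors k = filter (λ bs → ¬? (bs ≟ᵇ replicate k false)) (bitVectors k)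

length-nonzeroBitVectors : ∀ k → length (nonzeroBitVectors k) ≤ 2 ^ k ∸ 1
length-nonzeroBitVectors k = ℕ.∸-monoˡ-≤ 1 (ℕ.≤-trans
  (filter-notAll _ (bitVectors k) (Any.map (λ 𝟎≡z z≢𝟎 → z≢𝟎 (sym 𝟎≡z)) (∈-bitVectors (replicate k false))))
  (ℕ.≤-reflexive (length-bitVectors k)))

-- Linear algebra over 𝔽₂

⊕-self : (v : 𝔽₂^ n) → v ⊕ v ≡ 𝟎
⊕-self []      = refl
⊕-self (b ∷ v) = cong₂ _∷_ (Bool.xor-same b) (⊕-self v)

⊕-identityʳ : (v : 𝔽₂^ n) → v ⊕ 𝟎 ≡ v
⊕-identityʳ = Vec.zipWith-identityʳ Bool.xor-identityʳ

⊕-identityˡ : (v : 𝔽₂^ n) → 𝟎 ⊕ v ≡ v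
⊕-identityˡ = Vec.zipWith-identityˡ Bool.xor-identityˡ

true· : (v : 𝔽₂^ n) → true · v ≡ v
true· = Vec.map-id

false· : (v : 𝔽₂^ n) → false · v ≡ 𝟎
false· v = Vec.map-const v false

≐ˢ-trans : (U V W : Subspace n) → U ≐ˢ V → V ≐ˢ W → U ≐ˢ W
≐ˢ-trans _ _ _ (U⊆V , V⊆U) (V⊆W , W⊆V) = V⊆W ∘ U⊆V , V⊆U ∘ W⊆V

≐ˢ-sym : (U V : Subspace n) → U ≐ˢ V → V ≐ˢ U
≐ˢ-sym _ _ (U⊆V , V⊆U) = V⊆U , U⊆V

HasDimension-resp : (U V : Subspace n) → U ≐ˢ V → HasDimension U k → HasDimension V k
HasDimension-resp _ _ (U⊆V , V⊆U) (vs , basis) = vs , record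
  { members     = VecAll.map U⊆V members
  ; spanning    = spanning ∘ V⊆U
  ; independent = independent
  } where open IsBasis basis

linearCombination-zeros : (vs : Vec (𝔽₂^ n) k) → linearCombination (replicate k false) vs ≡ 𝟎
linearCombination-zeros []       = refl
linearCombination-zeros (v ∷ vs) =
  trans (cong₂ _⊕_ (false· v) (linearCombination-zeros vs)) (⊕-identityˡ 𝟎)

linearCombination-mem : (X : Subspace n) {vs : Vec (𝔽₂^ n) k} → VecAll.All (carrier X) vs →
                        ∀ bs → linearCombination bs vs ∈ carrier X
linearCombination-mem X VecAll.[]         []       = Subspace.𝟎-mem X
linearCombination-mem X (v∈X VecAll.∷ vs) (b ∷ bs) =
  Subspace.⊕-closed X (Subspace.·-closed X b v∈X) (linearCombination-mem X vs bs)

-- Each degenerate case yields a nontrivial relation, with coefficients (1,0), (0,1) and (1,1) in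
-- turn.
basis-distinct : {T : Subspace n} {u v : 𝔽₂^ n} → IsBasis T (u ∷ v ∷ []) → u ≢ 𝟎 × v ≢ 𝟎 × u ≢ v
basis-distinct {u = u} {v} basis = u≢𝟎 , v≢𝟎 , u≢v
  where
  open IsBasis basis
  u≢𝟎 : u ≢ 𝟎
  u≢𝟎 refl with () ← independent (true ∷ false ∷ [])
    (trans (cong₂ _⊕_ (true· 𝟎) (trans (⊕-identityʳ _) (false· v))) (⊕-identityʳ 𝟎))
  v≢𝟎 : v ≢ 𝟎
  v≢𝟎 refl with () ← independent (false ∷ true ∷ [])
    (trans (cong₂ _⊕_ (false· u) (trans (⊕-identityʳ _) (true· 𝟎))) (⊕-identityʳ 𝟎))
  u≢v : u ≢ v
  u≢v refl with () ← independent (true ∷ true ∷ [])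
    (trans (cong₂ _⊕_ (true· u) (trans (⊕-identityʳ _) (true· u))) (⊕-self u))

-- Over 𝔽₂ additivity already gives linearity, because the only scalars are 0 and 1.
module Additive (g : 𝔽₂^ n → 𝔽₂^ n) (g-⊕ : ∀ u v → g (u ⊕ v) ≡ g u ⊕ g v) where

  preserves-𝟎 : g 𝟎 ≡ 𝟎
  preserves-𝟎 = trans (cong g (sym (⊕-self 𝟎))) (trans (g-⊕ 𝟎 𝟎) (⊕-self (g 𝟎)))

  preserves-· : ∀ b v → g (b · v) ≡ b · g v
  preserves-· true  v = trans (cong g (true· v)) (sym (true· (g v)))
  preserves-· false v = trans (cong g (false· v)) (trans preserves-𝟎 (sym (false· (g v))))

  preserves-linearCombination : ∀ (bs : Vec Bool k) vs →
    g (linearCombination bs vs) ≡ linearCombination bs (Vec.map g vs)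
  preserves-linearCombination []       []       = preserves-𝟎
  preserves-linearCombination (b ∷ bs) (v ∷ vs) =
    trans (g-⊕ _ _) (cong₂ _⊕_ (preserves-· b v) (preserves-linearCombination bs vs))

  preimage : Subspace n → Subspace n
  preimage X = record
    { carrier  = λ v → g v ∈ carrier X
    ; 𝟎-mem    = subst (carrier X) (sym preserves-𝟎) (Subspace.𝟎-mem X)
    ; ⊕-closed = λ u∈ v∈ → subst (carrier X) (sym (g-⊕ _ _)) (Subspace.⊕-closed X u∈ v∈)
    ; ·-closed = λ b v∈ → subst (carrier X) (sym (preserves-· b _)) (Subspace.·-closed X b v∈)
    }

-- The basis is pulled back along the inverse `h`, whose additivity follows from that of `g`.
preimage-dimension : (g h : 𝔽₂^ n → 𝔽₂^ n) (g-⊕ : ∀ u v → g (u ⊕ v) ≡ g u ⊕ g v) →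
  (∀ w → g (h w) ≡ w) → (∀ v → h (g v) ≡ v) →
  ∀ {X} → HasDimension X k → HasDimension (Additive.preimage g g-⊕ X) k
preimage-dimension g h g-⊕ gh hg {X} (vs , basis) = Vec.map h vs , record
  { members     = VecAll.map⁺ (VecAll.map (λ {v} → subst (carrier X) (sym (gh v))) members)
  ; spanning    = λ {v} gv∈ → let bs , eq = spanning gv∈ in
      bs , trans (sym (H.preserves-linearCombination bs vs)) (trans (cong h eq) (hg v))
  ; independent = λ bs eq → independent bs
      (trans (sym (gh _)) (trans (cong g (trans (H.preserves-linearCombination bs vs) eq)) G.preserves-𝟎))
  }
  where
  open IsBasis basis
  h-⊕ : ∀ u v → h (u ⊕ v) ≡ h u ⊕ h v
  h-⊕ u v = trans (cong h (trans (cong₂ _⊕_ (sym (gh u)) (sym (gh v))) (sym (g-⊕ _ _)))) (hg _)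
  module G = Additive g g-⊕
  module H = Additive h h-⊕

-- Powers in a field

module FieldPowers {c ℓ} (F : CommutativeRing c ℓ) (F-field : IsField F) where
  open CommutativeRing F hiding (zero)
    renaming (_+_ to _+ᶠ_; _*_ to _*ᶠ_; refl to ≈-refl; sym to ≈-sym; trans to ≈-trans; setoid to F-setoid)
  open Exp semiring using (^-congˡ; ^-congʳ; ^-homo-*; ^-assocʳ) renaming (_^_ to _^ᶠ_)
  open CommExp commutativeSemiring using (^-distrib-*)
  open IsField F-field
  open SetoidReasoning F-setoid

  *-cancelˡ : ∀ {x y z} → ¬ (x ≈ 0#) → x *ᶠ y ≈ x *ᶠ z → y ≈ z
  *-cancelˡ {x} {y} {z} x≉0 eq with invertible x≉0
  ... | x⁻¹ , x⁻¹x≈1 , _ = ≈-trans (≈-sym (undo y)) (≈-trans (*-congˡ eq) (undo z))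
    where
    undo : ∀ w → x⁻¹ *ᶠ (x *ᶠ w) ≈ w
    undo w = ≈-trans (≈-sym (*-assoc _ _ _)) (≈-trans (*-congʳ x⁻¹x≈1) (*-identityˡ w))

  *-cancelʳ : ∀ {x y z} → ¬ (x ≈ 0#) → y *ᶠ x ≈ z *ᶠ x → y ≈ z
  *-cancelʳ x≉0 eq = *-cancelˡ x≉0 (≈-trans (*-comm _ _) (≈-trans eq (*-comm _ _)))

  *-nonzero : ∀ {x y} → ¬ (x ≈ 0#) → ¬ (y ≈ 0#) → ¬ (x *ᶠ y ≈ 0#)
  *-nonzero x≉0 y≉0 xy≈0 = y≉0 (*-cancelˡ x≉0 (≈-trans xy≈0 (≈-sym (zeroʳ _))))

  ^-nonzero : ∀ {x} → ¬ (x ≈ 0#) → ∀ e → ¬ (x ^ᶠ e ≈ 0#)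
  ^-nonzero x≉0 zero    = 1≉0
  ^-nonzero x≉0 (suc e) = *-nonzero x≉0 (^-nonzero x≉0 e)

  1^ : ∀ e → 1# ^ᶠ e ≈ 1#
  1^ zero    = ≈-refl
  1^ (suc e) = ≈-trans (*-identityˡ _) (1^ e)

  ^-cancel : ∀ {x} → ¬ (x ≈ 0#) → ∀ {i j} → i ≤ j → x ^ᶠ i ≈ x ^ᶠ j → x ^ᶠ (j ∸ i) ≈ 1#
  ^-cancel {x} x≉0 {i} {j} i≤j eq = ≈-sym (*-cancelˡ (^-nonzero x≉0 i) (begin
    x ^ᶠ i *ᶠ 1#              ≈⟨ *-identityʳ _ ⟩
    x ^ᶠ i                    ≈⟨ eq ⟩
    x ^ᶠ j                    ≡⟨ cong (x ^ᶠ_) (ℕ.m+[n∸m]≡n i≤j) ⟨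
    x ^ᶠ (i + (j ∸ i))        ≈⟨ ^-homo-* x i (j ∸ i) ⟩
    x ^ᶠ i *ᶠ x ^ᶠ (j ∸ i)    ∎))

  -- Here `p` is any positive exponent with `x ^ᶠ p ≈ 1#`, not necessarily the order of `x`; the
  -- computation of the order of `α` relies on this generality.
  ^-mod : ∀ {x} p .{{_ : NonZero p}} → x ^ᶠ p ≈ 1# → ∀ e → x ^ᶠ (toℕ (e mod p)) ≈ x ^ᶠ e
  ^-mod {x} p x^p≈1 e = ≈-sym (begin
    x ^ᶠ e                                ≡⟨ cong (x ^ᶠ_) (m≡m%n+[m/n]*n e p) ⟩
    x ^ᶠ (e % p + e / p * p)              ≈⟨ ^-homo-* x (e % p) _ ⟩
    x ^ᶠ (e % p) *ᶠ x ^ᶠ (e / p * p)      ≈⟨ *-congˡ (begin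
      x ^ᶠ (e / p * p)                      ≡⟨ cong (x ^ᶠ_) (ℕ.*-comm (e / p) p) ⟩
      x ^ᶠ (p * (e / p))                    ≈⟨ ^-assocʳ x p (e / p) ⟨
      (x ^ᶠ p) ^ᶠ (e / p)                   ≈⟨ ^-congˡ (e / p) x^p≈1 ⟩
      1# ^ᶠ (e / p)                         ≈⟨ 1^ (e / p) ⟩
      1#                                    ∎) ⟩
    x ^ᶠ (e % p) *ᶠ 1#                    ≈⟨ *-identityʳ _ ⟩
    x ^ᶠ (e % p)                          ≡⟨ cong (x ^ᶠ_) (Fin.toℕ-fromℕ< (m%n<n e p)) ⟨
    x ^ᶠ toℕ (e mod p)                    ∎)

  -- Iterated squaring: the powers of the Frobenius map.

  frob : ℕ → Carrier → Carrier
  frob i x = x ^ᶠ (2 ^ i)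

  frob-cong : ∀ i {x y} → x ≈ y → frob i x ≈ frob i y
  frob-cong i = ^-congˡ (2 ^ i)

  frob-+ : ∀ i j x → frob j (frob i x) ≈ frob (i + j) x
  frob-+ i j x = ≈-trans (^-assocʳ x (2 ^ i) (2 ^ j)) (^-congʳ x (sym (ℕ.^-distribˡ-+-* 2 i j)))

  frob-* : ∀ i x y → frob i (x *ᶠ y) ≈ frob i x *ᶠ frob i y
  frob-* i x y = ^-distrib-* x y (2 ^ i)

  -- Induction on `i`, squaring first: the two cross terms in the square of a sum agree and cancel
  -- in characteristic 2.
  frob-additive : (∀ x → x +ᶠ x ≈ 0#) → ∀ i x y → frob i (x +ᶠ y) ≈ frob i x +ᶠ frob i y
  frob-additive char2 zero    x y = ≈-trans (*-identityʳ _) (+-cong (≈-sym (*-identityʳ x)) (≈-sym (*-identityʳ y)))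
  frob-additive char2 (suc i) x y = begin
    frob (suc i) (x +ᶠ y)                    ≈⟨ ^-assocʳ (x +ᶠ y) 2 (2 ^ i) ⟨
    frob i ((x +ᶠ y) ^ᶠ 2)                   ≈⟨ frob-cong i square ⟩
    frob i (x ^ᶠ 2 +ᶠ y ^ᶠ 2)                ≈⟨ frob-additive char2 i _ _ ⟩
    frob i (x ^ᶠ 2) +ᶠ frob i (y ^ᶠ 2)       ≈⟨ +-cong (^-assocʳ x 2 (2 ^ i)) (^-assocʳ y 2 (2 ^ i)) ⟩
    frob (suc i) x +ᶠ frob (suc i) y         ∎
    where
    sq : ∀ z → z ^ᶠ 2 ≈ z *ᶠ z
    sq z = *-congˡ (*-identityʳ z)
    square : (x +ᶠ y) ^ᶠ 2 ≈ x ^ᶠ 2 +ᶠ y ^ᶠ 2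
    square = begin
      (x +ᶠ y) ^ᶠ 2                                            ≈⟨ sq _ ⟩
      (x +ᶠ y) *ᶠ (x +ᶠ y)                                     ≈⟨ distribʳ _ x y ⟩
      x *ᶠ (x +ᶠ y) +ᶠ y *ᶠ (x +ᶠ y)                           ≈⟨ +-cong (distribˡ x x y) (distribˡ y x y) ⟩
      (x *ᶠ x +ᶠ x *ᶠ y) +ᶠ (y *ᶠ x +ᶠ y *ᶠ y)                 ≈⟨ +-assoc _ _ _ ⟩
      x *ᶠ x +ᶠ (x *ᶠ y +ᶠ (y *ᶠ x +ᶠ y *ᶠ y))                 ≈⟨ +-congˡ (+-assoc _ _ _) ⟨
      x *ᶠ x +ᶠ ((x *ᶠ y +ᶠ y *ᶠ x) +ᶠ y *ᶠ y)                 ≈⟨ +-congˡ (+-congʳ (≈-trans (+-congˡ (*-comm y x)) (char2 _))) ⟩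
      x *ᶠ x +ᶠ (0# +ᶠ y *ᶠ y)                                 ≈⟨ +-cong (≈-sym (sq x)) (≈-trans (+-identityˡ _) (≈-sym (sq y))) ⟩
      x ^ᶠ 2 +ᶠ y ^ᶠ 2                                         ∎

  frob-fixed-* : ∀ {m x} → frob m x ≈ x → ∀ a → frob (a * m) x ≈ x
  frob-fixed-* fixed zero    = *-identityʳ _
  frob-fixed-* {m} fixed (suc a) =
    ≈-trans (≈-sym (frob-+ m (a * m) _)) (≈-trans (frob-cong (a * m) fixed) (frob-fixed-* fixed a))

  -- Bézout gives `a * m ≡ 1 + b * n`, so a single Frobenius step after `b * n` steps that fix `x`
  -- amounts to `a * m` steps, which fix `x` too. The other sign exchanges `m` and `n`.
  frob-fixed-coprime : Bézout.Identity 1 m n → ∀ {x} → frob m x ≈ x → frob n x ≈ x → frob 1 x ≈ x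
  frob-fixed-coprime {m} {n} (Bézout.+- a b eq) {x} fix-m fix-n = begin
    frob 1 x                  ≈⟨ frob-cong 1 (frob-fixed-* fix-n b) ⟨
    frob 1 (frob (b * n) x)   ≈⟨ frob-+ (b * n) 1 x ⟩
    frob (b * n + 1) x        ≡⟨ cong (λ e → frob e x) (trans (ℕ.+-comm (b * n) 1) eq) ⟩
    frob (a * m) x            ≈⟨ frob-fixed-* fix-m a ⟩
    x                         ∎
  frob-fixed-coprime (Bézout.-+ a b eq) fix-m fix-n =
    frob-fixed-coprime (Bézout.+- b a eq) fix-n fix-m

  frob-1-fixed : ∀ {x} → ¬ (x ≈ 0#) → frob 1 x ≈ x → x ≈ 1#
  frob-1-fixed {x} x≉0 eq = *-cancelˡ x≉0 (begin
    x *ᶠ x          ≈⟨ *-congˡ (*-identityʳ x) ⟨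
    frob 1 x        ≈⟨ eq ⟩
    x               ≈⟨ *-identityʳ x ⟨
    x *ᶠ 1#         ∎)

  -- When `n` Frobenius steps are the identity, numbers of steps count modulo `n`, and
  -- `frob (n ∸ i)` inverts `frob i` for `i ≤ n`.
  module FrobeniusOrder (n : ℕ) .{{_ : NonZero n}} (frob-n : ∀ x → frob n x ≈ x) where

    frob-% : ∀ i x → frob (i % n) x ≈ frob i x
    frob-% i x = begin
      frob (i % n) x                          ≈⟨ frob-fixed-* (frob-n _) (i / n) ⟨
      frob (i / n * n) (frob (i % n) x)       ≈⟨ frob-+ (i % n) (i / n * n) x ⟩
      frob (i % n + i / n * n) x              ≡⟨ cong (λ e → frob e x) (m≡m%n+[m/n]*n i n) ⟨
      frob i x                                ∎

    frob-undo : ∀ {i} → i ≤ n → ∀ x → frob (n ∸ i) (frob i x) ≈ x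
    frob-undo {i} i≤n x = begin
      frob (n ∸ i) (frob i x)   ≈⟨ frob-+ i (n ∸ i) x ⟩
      frob (i + (n ∸ i)) x      ≡⟨ cong (λ e → frob e x) (ℕ.m+[n∸m]≡n i≤n) ⟩
      frob n x                  ≈⟨ frob-n x ⟩
      x                         ∎

    frob-redo : ∀ {i} → i ≤ n → ∀ x → frob i (frob (n ∸ i) x) ≈ x
    frob-redo {i} i≤n x = begin
      frob i (frob (n ∸ i) x)   ≈⟨ frob-+ (n ∸ i) i x ⟩
      frob (n ∸ i + i) x        ≡⟨ cong (λ e → frob e x) (ℕ.m∸n+n≡m i≤n) ⟩
      frob n x                  ≈⟨ frob-n x ⟩
      x                         ∎

    frob-sym : ∀ i {x y} → frob i x ≈ y → ∃ λ (j : Fin n) → frob (toℕ j) y ≈ x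
    -- The outer `mod n` serves the case `i % n ≡ 0`, where `n ∸ i % n` is `n` itself and lies
    -- outside the range of `Fin n`.
    frob-sym i {x} {y} eq = (n ∸ i % n) mod n , (begin
      frob (toℕ ((n ∸ i % n) mod n)) y     ≡⟨ cong (λ e → frob e y) (Fin.toℕ-fromℕ< (m%n<n (n ∸ i % n) n)) ⟩
      frob ((n ∸ i % n) % n) y             ≈⟨ frob-% (n ∸ i % n) y ⟩
      frob (n ∸ i % n) y                   ≈⟨ frob-cong (n ∸ i % n) (≈-trans (≈-sym eq) (≈-sym (frob-% i x))) ⟩
      frob (n ∸ i % n) (frob (i % n) x)    ≈⟨ frob-undo (ℕ.<⇒≤ (m%n<n i n)) x ⟩
      x                                    ∎)

    frob-injective : ∀ i {x y} → frob i x ≈ frob i y → x ≈ y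
    frob-injective i {x} {y} eq = begin
      x                                    ≈⟨ frob-undo i%n≤n x ⟨
      frob (n ∸ i % n) (frob (i % n) x)    ≈⟨ frob-cong (n ∸ i % n) (≈-trans (frob-% i x) (≈-trans eq (≈-sym (frob-% i y)))) ⟩
      frob (n ∸ i % n) (frob (i % n) y)    ≈⟨ frob-undo i%n≤n y ⟩
      y                                    ∎
      where i%n≤n = ℕ.<⇒≤ (m%n<n i n)

    frob-≉1 : ∀ i {x} → ¬ (x ≈ 1#) → ¬ (frob i x ≈ 1#)
    frob-≉1 i x≉1 eq = x≉1 (frob-injective i (≈-trans eq (≈-sym (1^ (2 ^ i)))))

    -- A coincidence would fix x under a power of Frobenius coprime to the prime n,
    -- hence under Frobenius itself, putting x in the prime field.
    frob-<-distinct : Prime n → ∀ {x} → ¬ (x ≈ 0#) → ¬ (x ≈ 1#) →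
                      ∀ {i j} → i < j → j < n → ¬ (frob i x ≈ frob j x)
    frob-<-distinct n-prime {x} x≉0 x≉1 {i} {j} i<j j<n eq = x≉1 (frob-1-fixed x≉0
      (frob-fixed-coprime (coprime-Bézout n⊥j∸i) (frob-n x) (≈-sym (frob-injective i (begin
        frob i x                   ≈⟨ eq ⟩
        frob j x                   ≡⟨ cong (λ e → frob e x) (ℕ.m∸n+n≡m (ℕ.<⇒≤ i<j)) ⟨
        frob (j ∸ i + i) x         ≈⟨ frob-+ (j ∸ i) i x ⟨
        frob i (frob (j ∸ i) x)    ∎)))))
      where
      n⊥j∸i = prime⇒coprime n-prime {{>-nonZero (ℕ.m<n⇒0<n∸m i<j)}} (ℕ.≤-<-trans (ℕ.m∸n≤m j i) j<n)

    frob-distinct : Prime n → ∀ {x} → ¬ (x ≈ 0#) → ¬ (x ≈ 1#) →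
                    ∀ {i j} → i < n → j < n → frob i x ≈ frob j x → i ≡ j
    frob-distinct n-prime x≉0 x≉1 {i} {j} i<n j<n eq with ℕ.<-cmp i j
    ... | tri≈ _ i≡j _ = i≡j
    ... | tri< i<j _ _ = contradiction eq (frob-<-distinct n-prime x≉0 x≉1 i<j j<n)
    ... | tri> _ _ j<i = contradiction (≈-sym eq) (frob-<-distinct n-prime x≉0 x≉1 j<i i<n)

  -- Powers of a primitive element and discrete logarithms.

  module PrimitiveElement {q} .{{_ : NonZero (q ∸ 1)}} (order : HasOrder F q)
                          {α : Carrier} (α-primitive : IsPrimitive F α) where
    open IsPrimitive α-primitive
    private module O = Inverse order

    order-injective : ∀ {x y} → O.to x ≡ O.to y → x ≈ y
    order-injective {x} {y} eq = ≈-trans (≈-sym (O.strictlyInverseʳ x)) (≈-trans (O.from-cong eq) (O.strictlyInverseʳ y))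

    _≟ᶠ_ : ∀ x y → Dec (x ≈ y)
    x ≟ᶠ y = map′ order-injective O.to-cong (O.to x Fin.≟ O.to y)

    order-from-injective : ∀ {i j} → O.from i ≈ O.from j → i ≡ j
    order-from-injective eq = trans (sym (O.strictlyInverseˡ _)) (trans (O.to-cong eq) (O.strictlyInverseˡ _))

    -- Sending zero to `zero` and the power of `α` with exponent `e` to `suc (e mod p)` embeds the
    -- whole field into `p + 1` elements.
    order-lower-bound : ∀ p .{{_ : NonZero p}} → α ^ᶠ p ≈ 1# → q ∸ 1 ≤ p
    order-lower-bound p α^p≈1 = ℕ.∸-monoˡ-≤ 1 (Fin.injective⇒≤ {f = code ∘ O.from} (order-from-injective ∘ code-injective))
      where
      code : Carrier → Fin (suc p)
      code x with x ≟ᶠ 0#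
      ... | yes _  = zero
      ... | no x≉0 = suc (proj₁ (generating x≉0) mod p)

      code-injective : ∀ {x y} → code x ≡ code y → x ≈ y
      code-injective {x} {y} eq with x ≟ᶠ 0# | y ≟ᶠ 0#
      ... | yes x≈0 | yes y≈0 = ≈-trans x≈0 (≈-sym y≈0)
      ... | no x≉0  | no y≉0  with generating x≉0 | generating y≉0
      ...   | d , α^d≈x | e , α^e≈y = begin
        x                      ≈⟨ α^d≈x ⟨
        α ^ᶠ d                 ≈⟨ ^-mod p α^p≈1 d ⟨
        α ^ᶠ toℕ (d mod p)     ≡⟨ cong (λ i → α ^ᶠ toℕ i) (Fin.suc-injective eq) ⟩
        α ^ᶠ toℕ (e mod p)     ≈⟨ ^-mod p α^p≈1 e ⟩
        α ^ᶠ e                 ≈⟨ α^e≈y ⟩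
        y                      ∎

    -- Pigeonhole on `0#` together with the powers of `α` with exponents from 0 to `q - 1`, which
    -- makes `q + 1` entries. No power equals `0#`, so two powers coincide, and `p` is the
    -- difference of their exponents.
    order-upper-bound : ∃[ p ] 0 < p × p ≤ q ∸ 1 × α ^ᶠ p ≈ 1#
    order-upper-bound with Fin.pigeonhole (ℕ.n<1+n q) (O.to ∘ value)
      where
      value : Fin (suc q) → Carrier
      value zero    = 0#
      value (suc i) = α ^ᶠ toℕ i
    ... | zero  , suc j , _       , eq = contradiction (≈-sym (order-injective eq)) (^-nonzero nonzero (toℕ j))
    ... | suc i , suc j , s≤s i<j , eq =
      toℕ j ∸ toℕ i , ℕ.m<n⇒0<n∸m i<j ,
      ℕ.≤-trans (ℕ.m∸n≤m (toℕ j) (toℕ i)) (ℕ.∸-monoˡ-≤ 1 (Fin.toℕ<n j)) ,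
      ^-cancel nonzero (ℕ.<⇒≤ i<j) (order-injective eq)

    α^[q∸1]≈1 : α ^ᶠ (q ∸ 1) ≈ 1#
    α^[q∸1]≈1 with order-upper-bound
    ... | p , 0<p , p≤ , α^p≈1 =
      ≈-trans (^-congʳ α (ℕ.≤-antisym (order-lower-bound p {{>-nonZero 0<p}} α^p≈1) p≤)) α^p≈1

    E : Fin (q ∸ 1) → Carrier
    E i = α ^ᶠ toℕ i

    E-nonzero : ∀ i → ¬ (E i ≈ 0#)
    E-nonzero i = ^-nonzero nonzero (toℕ i)

    E-mod : ∀ e → E (e mod (q ∸ 1)) ≈ α ^ᶠ e
    E-mod = ^-mod (q ∸ 1) α^[q∸1]≈1

    -- Otherwise `α` would reach `1#` at a positive exponent below `q ∸ 1`.
    E-<-distinct : ∀ {i j} → i Fin.< j → ¬ (E i ≈ E j)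
    E-<-distinct {i} {j} i<j eq = contradiction
      (order-lower-bound (toℕ j ∸ toℕ i) {{>-nonZero (ℕ.m<n⇒0<n∸m i<j)}} (^-cancel nonzero (ℕ.<⇒≤ i<j) eq))
      (ℕ.<⇒≱ (ℕ.≤-<-trans (ℕ.m∸n≤m (toℕ j) (toℕ i)) (Fin.toℕ<n j)))

    E-injective : ∀ i j → E i ≈ E j → i ≡ j
    E-injective i j eq with Fin.<-cmp i j
    ... | tri≈ _ i≡j _ = i≡j
    ... | tri< i<j _ _ = contradiction eq (E-<-distinct i<j)
    ... | tri> _ _ j<i = contradiction (≈-sym eq) (E-<-distinct j<i)

    E-surjective : ∀ {x} → ¬ (x ≈ 0#) → ∃[ i ] E i ≈ x
    E-surjective x≉0 with generating x≉0
    ... | e , α^e≈x = e mod (q ∸ 1) , ≈-trans (E-mod e) α^e≈x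

    -- The value at 0# is a junk exponent.
    log : Carrier → Fin (q ∸ 1)
    log x with x ≟ᶠ 0#
    ... | yes _  = 0 mod (q ∸ 1)
    ... | no x≉0 = proj₁ (E-surjective x≉0)

    log-unique : ∀ {x i} → E i ≈ x → log x ≡ i
    log-unique {x} {i} eq with x ≟ᶠ 0#
    ... | yes x≈0 = contradiction (≈-trans eq x≈0) (E-nonzero i)
    ... | no x≉0  = E-injective _ i (≈-trans (proj₂ (E-surjective x≉0)) (≈-sym eq))

    -- The form `suc (q ∸ 1)` splits off one factor `x`. That factor settles the case of zero, and
    -- the remaining power is `1#` for nonzero `x`. For `q = 2 ^ n` this says that `frob n` is the
    -- identity.
    ^q-fixed : ∀ x → x ^ᶠ suc (q ∸ 1) ≈ x
    ^q-fixed x with x ≟ᶠ 0#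
    ... | yes x≈0 = ≈-trans (*-congʳ x≈0) (≈-trans (zeroˡ _) (≈-sym x≈0))
    ... | no x≉0 with generating x≉0
    ...   | e , α^e≈x = ≈-trans (*-congˡ (begin
      x ^ᶠ (q ∸ 1)             ≈⟨ ^-congˡ (q ∸ 1) α^e≈x ⟨
      (α ^ᶠ e) ^ᶠ (q ∸ 1)      ≈⟨ ^-assocʳ α e (q ∸ 1) ⟩
      α ^ᶠ (e * (q ∸ 1))       ≡⟨ cong (α ^ᶠ_) (ℕ.*-comm e (q ∸ 1)) ⟩
      α ^ᶠ ((q ∸ 1) * e)       ≈⟨ ^-assocʳ α (q ∸ 1) e ⟨
      (α ^ᶠ (q ∸ 1)) ^ᶠ e      ≈⟨ ^-congˡ e α^[q∸1]≈1 ⟩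
      1# ^ᶠ e                  ≈⟨ 1^ e ⟩
      1#                       ∎)) (*-identityʳ x)

-- The Steiner structure

module Cyclotomy {c ℓ} (n : ℕ) .{{_ : NonZero n}} (n-prime : Prime n) (F : CommutativeRing c ℓ) (F-field : IsField F)
                 (order : HasOrder F (2 ^ n)) (α : CommutativeRing.Carrier F) (α-primitive : IsPrimitive F α)
                 (φ : Identification F n) where

  open CommutativeRing F hiding (zero)
    renaming (_+_ to _+ᶠ_; _*_ to _*ᶠ_; refl to ≈-refl; sym to ≈-sym; trans to ≈-trans; setoid to F-setoid)
  open Exp semiring using (^-congʳ; ^-homo-*; ^-assocʳ) renaming (_^_ to _^ᶠ_)
  open CommSemigroup *-commutativeSemigroup using (x∙yz≈y∙xz)
  open SetoidReasoning F-setoid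

  private
    M : ℕ
    M = 2 ^ n ∸ 1

  open FieldPowers F F-field
  open PrimitiveElement {{2^n∸1≢0 {n}}} order α-primitive

  1+M≡2^n : 1 + M ≡ 2 ^ n
  1+M≡2^n = ℕ.m+[n∸m]≡n (ℕ.m^n>0 2 n)

  open FrobeniusOrder n (λ x → ≈-trans (^-congʳ x (sym 1+M≡2^n)) (^q-fixed x))
  open CosetDifferences {n = n} F φ α
  open Identification φ using (inverse; to; from; to-⊕; to-·)
  open Inverse inverse using (strictlyInverseˡ; strictlyInverseʳ; from-cong; to-cong)

  to-𝟎 : to 𝟎 ≈ 0#
  to-𝟎 = ≈-trans (to-cong (sym (false· 𝟎))) (≈-trans (to-· false 𝟎) (zeroˡ _))

  to-nonzero : ∀ {v} → v ≢ 𝟎 → ¬ (to v ≈ 0#)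
  to-nonzero v≢𝟎 eq = v≢𝟎 (trans (sym (strictlyInverseʳ _))
    (trans (from-cong (≈-trans eq (≈-sym to-𝟎))) (strictlyInverseʳ 𝟎)))

  char2 : ∀ x → x +ᶠ x ≈ 0#
  char2 x = begin
    x +ᶠ x                         ≈⟨ +-cong (strictlyInverseˡ x) (strictlyInverseˡ x) ⟨
    to (from x) +ᶠ to (from x)     ≈⟨ to-⊕ (from x) (from x) ⟨
    to (from x ⊕ from x)           ≡⟨ cong to (⊕-self (from x)) ⟩
    to 𝟎                           ≈⟨ to-𝟎 ⟩
    0#                             ∎

  from-+ : ∀ x y → from (x +ᶠ y) ≡ from x ⊕ from y
  from-+ x y = trans
    (from-cong (≈-sym (≈-trans (to-⊕ _ _) (+-cong (strictlyInverseˡ x) (strictlyInverseˡ y)))))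
    (strictlyInverseʳ _)

  -- Subtraction of exponents is division in the field: the extra `M` in the residue disappears
  -- because `α ^ᶠ M ≈ 1#`.
  E-⊖ : ∀ r s → E (_⊖_ {n} r s) *ᶠ E s ≈ E r
  E-⊖ r s = begin
    E (_⊖_ {n} r s) *ᶠ E s                      ≈⟨ *-congʳ (E-mod _) ⟩
    α ^ᶠ (toℕ r + (M ∸ toℕ s)) *ᶠ E s           ≈⟨ ^-homo-* α (toℕ r + (M ∸ toℕ s)) (toℕ s) ⟨
    α ^ᶠ (toℕ r + (M ∸ toℕ s) + toℕ s)          ≡⟨ cong (α ^ᶠ_) (trans (ℕ.+-assoc (toℕ r) _ _)
                                                      (cong (toℕ r +_) (ℕ.m∸n+n≡m (ℕ.<⇒≤ (Fin.toℕ<n s))))) ⟩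
    α ^ᶠ (toℕ r + M)                            ≈⟨ ^-homo-* α (toℕ r) M ⟩
    E r *ᶠ α ^ᶠ M                               ≈⟨ *-congˡ α^[q∸1]≈1 ⟩
    E r *ᶠ 1#                                   ≈⟨ *-identityʳ _ ⟩
    E r                                         ∎

  E-⊖-≉1 : ∀ {r s} → r ≢ s → ¬ (E (_⊖_ {n} r s) ≈ 1#)
  E-⊖-≉1 {r} {s} r≢s eq = r≢s (E-injective r s (begin
    E r                        ≈⟨ E-⊖ r s ⟨
    E (_⊖_ {n} r s) *ᶠ E s     ≈⟨ *-congʳ eq ⟩
    1# *ᶠ E s                  ≈⟨ *-identityˡ _ ⟩
    E s                        ∎))

  E-⊖-≉1⇒≢ : ∀ {r s} → ¬ (E (_⊖_ {n} r s) ≈ 1#) → r ≢ s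
  E-⊖-≉1⇒≢ {r} ≉1 refl = ≉1 (*-cancelʳ (E-nonzero r) (≈-trans (E-⊖ r r) (≈-sym (*-identityˡ _))))

  E-double : ∀ s i → E ((toℕ s * 2 ^ i) mod M) ≈ frob i (E s)
  E-double s i = ≈-trans (E-mod _) (≈-sym (^-assocʳ α (toℕ s) (2 ^ i)))

  divide : ∀ {x y} → ¬ (x ≈ 0#) → ¬ (y ≈ 0#) → ∃[ j ] E j *ᶠ y ≈ x
  divide {x} {y} x≉0 y≉0 with E-surjective x≉0 | E-surjective y≉0
  ... | r , Er≈x | s , Es≈y = _⊖_ {n} r s , ≈-trans (*-congˡ (≈-sym Es≈y)) (≈-trans (E-⊖ r s) Er≈x)

  -- Cyclotomic cosets as Frobenius orbits.

  ρ-orbit : ∀ s → ∃[ i ] frob i (E s) ≈ E (ρ {n} s)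
  ρ-orbit s with Extrema.argmin-sel (Fin.≤-totalOrder M) id s (cyclotomicCoset {n} s)
  -- The default value given to the minimum is `s` itself, reached after zero Frobenius steps.
  ... | inj₁ ρs≡s = 0 , ≈-trans (*-identityʳ _) (reflexive (cong E (sym ρs≡s)))
  ... | inj₂ ρs∈ with ∈-map⁻ _ ρs∈
  ...   | i , _ , ρs≡ = i , ≈-trans (≈-sym (E-double s i)) (reflexive (cong E (sym ρs≡)))

  -- The number of steps `i` is arbitrary, while the coset is listed for steps below `n` only;
  -- reducing `i` modulo `n` locates `t` in that list.
  ρ-minimal : ∀ i s t → frob i (E s) ≈ E t → ρ {n} s Fin.≤ t
  ρ-minimal i s t eq = All.lookup (Extrema.min≤xs (Fin.≤-totalOrder M) s (cyclotomicCoset {n} s)) t∈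
    where
    t≡ : (toℕ s * 2 ^ (i % n)) mod M ≡ t
    t≡ = E-injective ((toℕ s * 2 ^ (i % n)) mod M) t (≈-trans (E-double s (i % n)) (≈-trans (frob-% i (E s)) eq))
    t∈ : t ∈ˡ cyclotomicCoset {n} s
    t∈ = subst (_∈ˡ cyclotomicCoset {n} s) t≡ (∈-map⁺ _ (∈-upTo⁺ (m%n<n i n)))

  ρ-≤ : ∀ i s t → frob i (E s) ≈ E t → ρ {n} s Fin.≤ ρ {n} t
  ρ-≤ i s t eq with ρ-orbit t
  ... | j , eq′ = ρ-minimal (i + j) s (ρ {n} t) (≈-trans (≈-sym (frob-+ i j (E s))) (≈-trans (frob-cong j eq) eq′))

  -- Lying in one orbit is a symmetric relation, so `ρ-≤` applies in both directions.
  ρ-invariant : ∀ i s t → frob i (E s) ≈ E t → ρ {n} s ≡ ρ {n} t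
  ρ-invariant i s t eq with frob-sym i eq
  ... | j , eq′ = Fin.≤-antisym (ρ-≤ i s t eq) (ρ-≤ (toℕ j) t s eq′)

  ρ-idempotent : ∀ s → ρ {n} (ρ {n} s) ≡ ρ {n} s
  ρ-idempotent s = sym (ρ-invariant (proj₁ (ρ-orbit s)) s (ρ {n} s) (proj₂ (ρ-orbit s)))

  -- A finite stand-in for `exponents X`: for a basis `vs` it contains every exponent, and its
  -- length is bounded by the number of nonzero coefficient vectors.
  exponentList : Vec (𝔽₂^ n) k → List (Fin M)
  exponentList {k} vs = List.map (λ bs → log (to (linearCombination bs vs))) (nonzeroBitVectors k)

  ∈-exponentList : ∀ {X} {vs : Vec (𝔽₂^ n) k} → IsBasis X vs → ∀ {r} → r ∈ exponents X → r ∈ˡ exponentList vs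
  ∈-exponentList {k} {vs = vs} basis {r} r∈ with IsBasis.spanning basis r∈
  ... | bs , eq = subst (_∈ˡ exponentList vs) (log-unique Er≈)
      (∈-map⁺ _ (∈-filter⁺ (λ bs → ¬? (bs ≟ᵇ replicate k false)) (∈-bitVectors bs) bs≢𝟎))
    where
    Er≈ : E r ≈ to (linearCombination bs vs)
    Er≈ = ≈-trans (≈-sym (strictlyInverseˡ (E r))) (to-cong (sym eq))
    bs≢𝟎 : bs ≢ replicate k false
    bs≢𝟎 refl = E-nonzero r (≈-trans Er≈ (≈-trans (to-cong (linearCombination-zeros vs)) to-𝟎))

  length-exponentList : (vs : Vec (𝔽₂^ n) k) → length (exponentList vs) ≤ 2 ^ k ∸ 1
  length-exponentList {k} vs = ℕ.≤-trans (ℕ.≤-reflexive (length-map _ (nonzeroBitVectors k))) (length-nonzeroBitVectors k)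

  -- At most (2ᵏ-1)(2ᵏ-2) pairs of exponents produce exactly that many coset differences.
  difference-injective : ∀ {X} → HasDimension X k → CosetComplete k X →
    ∀ {r s r′ s′} → r ∈ exponents X → s ∈ exponents X → r ≢ s →
    r′ ∈ exponents X → s′ ∈ exponents X → r′ ≢ s′ →
    ρ {n} (_⊖_ {n} r s) ≡ ρ {n} (_⊖_ {n} r′ s′) → (r , s) ≡ (r′ , s′)
  difference-injective {k} {X} (vs , basis) complete r∈ s∈ r≢s r′∈ s′∈ r′≢s′ with enumeration complete
  ... | f , f-injective , f-mem =
    injective-on-list (≡-dec Fin._≟_ Fin._≟_) (λ p → ρ {n} (_⊖_ {n} (proj₁ p) (proj₂ p))) pairs f-injective onto short
      (pair∈ r∈ s∈ r≢s) (pair∈ r′∈ s′∈ r′≢s′)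
    where
    L = exponentList vs
    pairs = distinctPairs Fin._≟_ L
    pair∈ : ∀ {r s} → r ∈ exponents X → s ∈ exponents X → r ≢ s → (r , s) ∈ˡ pairs
    pair∈ r∈ s∈ = ∈-distinctPairs Fin._≟_ (∈-exponentList basis r∈) (∈-exponentList basis s∈)
    onto : ∀ i → ∃[ z ] z ∈ˡ pairs × f i ≡ ρ {n} (_⊖_ {n} (proj₁ z) (proj₂ z))
    onto i with f-mem i
    ... | r , s , r∈ , s∈ , r≢s , eq = (r , s) , pair∈ r∈ s∈ r≢s , eq
    short : length pairs ≤ (2 ^ k ∸ 1) * (2 ^ k ∸ 2)
    short = ℕ.≤-trans (length-distinctPairs Fin._≟_ L) (ℕ.*-mono-≤ (length-exponentList vs)
      (ℕ.≤-trans (ℕ.∸-monoˡ-≤ 1 (length-exponentList vs)) (ℕ.≤-reflexive (ℕ.∸-+-assoc (2 ^ k) 1 1))))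

  -- Blocks are preimages rather than images: x ↦ αʲ x^(2ⁱ) ranges over a group, so the family is the same.
  twist : Fin M → Fin n → 𝔽₂^ n → 𝔽₂^ n
  twist j i v = from (E j *ᶠ frob (toℕ i) (to v))

  twist-⊕ : ∀ j i u v → twist j i (u ⊕ v) ≡ twist j i u ⊕ twist j i v
  twist-⊕ j i u v = trans (from-cong (begin
    E j *ᶠ frob (toℕ i) (to (u ⊕ v))                              ≈⟨ *-congˡ (frob-cong (toℕ i) (to-⊕ u v)) ⟩
    E j *ᶠ frob (toℕ i) (to u +ᶠ to v)                            ≈⟨ *-congˡ (frob-additive char2 (toℕ i) _ _) ⟩
    E j *ᶠ (frob (toℕ i) (to u) +ᶠ frob (toℕ i) (to v))           ≈⟨ distribˡ _ _ _ ⟩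
    E j *ᶠ frob (toℕ i) (to u) +ᶠ E j *ᶠ frob (toℕ i) (to v)      ∎)) (from-+ _ _)

  block : Subspace n → Fin M → Fin n → Subspace n
  block X j i = Additive.preimage (twist j i) (twist-⊕ j i) X

  -- The inverse of a twist multiplies by the inverse of `E j` and then completes the Frobenius
  -- cycle with `n ∸ toℕ i` further steps.
  block-dimension : ∀ {X} → HasDimension X k → ∀ j i → HasDimension (block X j i) k
  block-dimension X-dim j i with divide (IsField.1≉0 F-field) (E-nonzero j)
  ... | j′ , j′j≈1 = preimage-dimension (twist j i) untwist (twist-⊕ j i) twist-untwist untwist-twist X-dim
    where
    i≤n = ℕ.<⇒≤ (Fin.toℕ<n i)
    untwist : 𝔽₂^ n → 𝔽₂^ n
    untwist w = from (frob (n ∸ toℕ i) (E j′ *ᶠ to w))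
    twist-untwist : ∀ w → twist j i (untwist w) ≡ w
    twist-untwist w = trans (from-cong (begin
      E j *ᶠ frob (toℕ i) (to (untwist w))      ≈⟨ *-congˡ (frob-cong (toℕ i) (strictlyInverseˡ _)) ⟩
      E j *ᶠ frob (toℕ i) (frob (n ∸ toℕ i) (E j′ *ᶠ to w))   ≈⟨ *-congˡ (frob-redo i≤n _) ⟩
      E j *ᶠ (E j′ *ᶠ to w)                     ≈⟨ *-assoc _ _ _ ⟨
      (E j *ᶠ E j′) *ᶠ to w                     ≈⟨ *-congʳ (≈-trans (*-comm _ _) j′j≈1) ⟩
      1# *ᶠ to w                                ≈⟨ *-identityˡ _ ⟩
      to w                                      ∎)) (strictlyInverseʳ w)
    untwist-twist : ∀ v → untwist (twist j i v) ≡ v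
    untwist-twist v = trans (from-cong (begin
      frob (n ∸ toℕ i) (E j′ *ᶠ to (twist j i v))                      ≈⟨ frob-cong (n ∸ toℕ i) (*-congˡ (strictlyInverseˡ _)) ⟩
      frob (n ∸ toℕ i) (E j′ *ᶠ (E j *ᶠ frob (toℕ i) (to v)))          ≈⟨ frob-cong (n ∸ toℕ i) (≈-trans (≈-sym (*-assoc _ _ _)) (≈-trans (*-congʳ j′j≈1) (*-identityˡ _))) ⟩
      frob (n ∸ toℕ i) (frob (toℕ i) (to v))                           ≈⟨ frob-undo i≤n _ ⟩
      to v                                                             ∎)) (strictlyInverseʳ v)

  block-exponent : ∀ {X} j i {v} → v ≢ 𝟎 → v ∈ carrier (block X j i) →
                   ∃[ r ] r ∈ exponents X × E r ≈ E j *ᶠ frob (toℕ i) (to v)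
  block-exponent {X} j i v≢𝟎 v∈ with E-surjective (*-nonzero (E-nonzero j) (^-nonzero (to-nonzero v≢𝟎) (2 ^ toℕ i)))
  ... | r , Er≈ = r , subst (carrier X) (from-cong (≈-sym Er≈)) v∈ , Er≈

  ratio : ∀ {u v} → u ≢ 𝟎 → v ≢ 𝟎 → u ≢ v → ∃[ d ] ¬ (E d ≈ 1#) × E d *ᶠ to v ≈ to u
  ratio {u} {v} u≢𝟎 v≢𝟎 u≢v with divide (to-nonzero u≢𝟎) (to-nonzero v≢𝟎)
  ... | d , eq = d , Ed≉1 , eq
    where
    Ed≉1 : ¬ (E d ≈ 1#)
    Ed≉1 Ed≈1 = u≢v (trans (sym (strictlyInverseʳ u)) (trans
      (from-cong (≈-trans (≈-sym eq) (≈-trans (*-congʳ Ed≈1) (*-identityˡ _)))) (strictlyInverseʳ v)))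

  -- Quotients survive a twist up to a Frobenius power, because the common factor `E j` cancels.
  twist-ratio : ∀ {d x y} j i → E d *ᶠ y ≈ x → frob i (E d) *ᶠ (E j *ᶠ frob i y) ≈ E j *ᶠ frob i x
  twist-ratio {d} {x} {y} j i eq = begin
    frob i (E d) *ᶠ (E j *ᶠ frob i y)     ≈⟨ x∙yz≈y∙xz _ _ _ ⟩
    E j *ᶠ (frob i (E d) *ᶠ frob i y)     ≈⟨ *-congˡ (frob-* i _ _) ⟨
    E j *ᶠ frob i (E d *ᶠ y)              ≈⟨ *-congˡ (frob-cong i eq) ⟩
    E j *ᶠ frob i x                       ∎

  -- The quotient of the twisted pair can be read in two ways, as the Frobenius image of `E d` and
  -- as a difference of exponents. This ties `d` to the coset of `r ⊖ s`.
  frob-ratio : ∀ {d r s x y} j i → E d *ᶠ y ≈ x → E r ≈ E j *ᶠ frob i x → E s ≈ E j *ᶠ frob i y →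
               frob i (E d) ≈ E (_⊖_ {n} r s)
  frob-ratio {d} {r} {s} {x} {y} j i d*y≈x Er≈ Es≈ = *-cancelʳ (E-nonzero s) (begin
    frob i (E d) *ᶠ E s                     ≈⟨ *-congˡ Es≈ ⟩
    frob i (E d) *ᶠ (E j *ᶠ frob i y)       ≈⟨ twist-ratio {d} j i d*y≈x ⟩
    E j *ᶠ frob i x                         ≈⟨ Er≈ ⟨
    E r                                     ≈⟨ E-⊖ r s ⟨
    E (_⊖_ {n} r s) *ᶠ E s                  ∎)

  -- Families of pairwise disjoint coset complete subspaces.

  module _ {k N : ℕ} (count : N * ((2 ^ k ∸ 1) * (2 ^ k ∸ 2) * n) ≡ 2 ^ n ∸ 2)
           (X : Fin N → Subspace n) (X-dim : ∀ t → HasDimension (X t) k)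
           (complete : ∀ t → CosetComplete k (X t)) (disjoint : ∀ t t′ → t ≢ t′ → Disjoint (X t) (X t′)) where

    private
      K : ℕ
      K = (2 ^ k ∸ 1) * (2 ^ k ∸ 2)

    rep : Fin N → Fin K → Fin M
    rep t = proj₁ (enumeration (complete t))

    rep-injective : ∀ t → Injective _≡_ _≡_ (rep t)
    rep-injective t = proj₁ (proj₂ (enumeration (complete t)))

    rep-mem : ∀ t e → rep t e ∈ ρΔ (X t)
    rep-mem t = proj₂ (proj₂ (enumeration (complete t)))

    ρΔ-fixed : ∀ {t d} → d ∈ ρΔ (X t) → ρ {n} d ≡ d
    ρΔ-fixed (r , s , _ , _ , _ , refl) = ρ-idempotent (_⊖_ {n} r s)

    -- A Frobenius power takes only `1#` to `1#`, and `r ≢ s` makes the quotient different from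
    -- `1#`.
    ρΔ-≉1 : ∀ {t d} → d ∈ ρΔ (X t) → ¬ (E d ≈ 1#)
    ρΔ-≉1 (r , s , _ , _ , r≢s , refl) eq with ρ-orbit (_⊖_ {n} r s)
    ... | i , eq′ = frob-≉1 i (E-⊖-≉1 r≢s) (≈-trans eq′ eq)

    ρΔ-index : ∀ {t t′ d} → d ∈ ρΔ (X t) → d ∈ ρΔ (X t′) → t ≡ t′
    ρΔ-index {t} {t′} d∈ d∈′ with t Fin.≟ t′
    ... | yes t≡t′ = t≡t′
    ... | no t≢t′  = contradiction (d∈ , d∈′) (disjoint t t′ t≢t′)

    shift : Fin N → Fin K → Fin n → Fin M
    shift t e i = (toℕ (rep t e) * 2 ^ toℕ i) mod M

    -- Both sides lie in one cyclotomic coset, so their representatives agree, each being fixed by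
    -- `ρ`. Disjointness then gives `t`, the enumeration gives `e`, and the distinctness of the `n`
    -- Frobenius images gives `i`.
    shift-injective : ∀ {t t′ e e′ i i′} → shift t e i ≡ shift t′ e′ i′ → t ≡ t′ × e ≡ e′ × i ≡ i′
    shift-injective {t} {t′} {e} {e′} {i} {i′} eq = t≡t′ , e≡e′ t≡t′ rep≡ , Fin.toℕ-injective
        (frob-distinct n-prime (E-nonzero (rep t e)) (ρΔ-≉1 (rep-mem t e)) (Fin.toℕ<n i) (Fin.toℕ<n i′)
          (≈-trans shift≈ (≈-trans (E-double (rep t′ e′) (toℕ i′)) (frob-cong (toℕ i′) (reflexive (cong E (sym rep≡)))))))
      where
      shift≈ : frob (toℕ i) (E (rep t e)) ≈ E (shift t′ e′ i′)
      shift≈ = ≈-trans (≈-sym (E-double (rep t e) (toℕ i))) (reflexive (cong E eq))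
      rep≡ : rep t e ≡ rep t′ e′
      rep≡ = trans (sym (ρΔ-fixed (rep-mem t e))) (trans (trans
        (ρ-invariant (toℕ i) (rep t e) (shift t′ e′ i′) shift≈)
        (sym (ρ-invariant (toℕ i′) (rep t′ e′) (shift t′ e′ i′) (≈-sym (E-double (rep t′ e′) (toℕ i′)))))) (ρΔ-fixed (rep-mem t′ e′)))
      t≡t′ : t ≡ t′
      t≡t′ = ρΔ-index (rep-mem t e) (subst (ρΔ (X t′)) (sym rep≡) (rep-mem t′ e′))
      e≡e′ : ∀ {t t′} → t ≡ t′ → rep t e ≡ rep t′ e′ → e ≡ e′
      e≡e′ {t} refl = rep-injective t

    splitIndex : Fin (N * (K * n)) → Fin N × Fin K × Fin n
    splitIndex x = proj₁ (Fin.remQuot {N} (K * n) x) , Fin.remQuot {K} n (proj₂ (Fin.remQuot {N} (K * n) x))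

    splitIndex-injective : ∀ x y → splitIndex x ≡ splitIndex y → x ≡ y
    splitIndex-injective x y eq = remQuot-injective {N} (K * n) x y
      (cong₂ _,_ (cong proj₁ eq) (remQuot-injective {K} n _ _ (cong proj₂ eq)))

    shift³ : Fin N × Fin K × Fin n → Fin M
    shift³ (t , e , i) = shift t e i

    shift³-injective : ∀ x y → shift³ x ≡ shift³ y → x ≡ y
    shift³-injective (t , e , i) (t′ , e′ , i′) eq =
      let t≡ , e≡ , i≡ = shift-injective {t} {t′} {e} {e′} {i} {i′} eq in cong₂ _,_ t≡ (cong₂ _,_ e≡ i≡)

    shift³-≢0 : ∀ x → shift³ x ≢ 0 mod M
    shift³-≢0 (t , e , i) eq = frob-≉1 (toℕ i) (ρΔ-≉1 (rep-mem t e))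
      (≈-trans (≈-sym (E-double (rep t e) (toℕ i))) (≈-trans (reflexive (cong E eq)) (E-mod 0)))

    -- The N K n = 2ⁿ-2 shifts are distinct and nonzero, so they exhaust the nonzero residues.
    shift³-onto : ∀ d → ¬ (E d ≈ 1#) → ∃[ x ] shift³ x ≡ d
    shift³-onto d Ed≉1 =
      let x , eq = onto-nonzero (shift³ ∘ splitIndex)
                     (λ {x} {y} eq → splitIndex-injective x y (shift³-injective (splitIndex x) (splitIndex y) eq))
                     (λ x → shift³-≢0 (splitIndex x)) enough
                     (λ d≡0 → Ed≉1 (≈-trans (reflexive (cong E d≡0)) (E-mod 0)))
      in splitIndex x , eq
      where
      -- Unfolded, this asks for `1 + M`, that is `2 ^ n`, to be at most `2 + (2 ^ n ∸ 2)`, which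
      -- holds for truncated subtraction.
      enough : M < 2 + N * (K * n)
      enough = ℕ.≤-trans (ℕ.≤-reflexive 1+M≡2^n)
        (ℕ.≤-trans (ℕ.m≤n+m∸n (2 ^ n) 2) (ℕ.≤-reflexive (cong (2 +_) (sym count))))

    -- The Frobenius power acts on the side of `d`, as it does in a twist, so the same `i` later
    -- indexes the block that catches a pair with quotient `E d`.
    Realises : Fin M → Fin N → Fin n → Set ℓ
    Realises d t i = ∃[ r ] ∃[ s ] r ∈ exponents (X t) × s ∈ exponents (X t) × frob (toℕ i) (E d) ≈ E (_⊖_ {n} r s)

    -- From `r ⊖ s`, `l` Frobenius steps lead to the representative and `i` more to the shift;
    -- `frob-sym` walks this path back.
    shift-realised : ∀ t e i → ∃[ i′ ] Realises (shift t e i) t i′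
    shift-realised t e i with rep-mem t e
    ... | r , s , r∈ , s∈ , _ , rep≡ with ρ-orbit (_⊖_ {n} r s)
    ...   | l , orbit with frob-sym (l + toℕ i) {E (_⊖_ {n} r s)} {E (shift t e i)} (begin
        frob (l + toℕ i) (E (_⊖_ {n} r s))            ≈⟨ frob-+ l (toℕ i) _ ⟨
        frob (toℕ i) (frob l (E (_⊖_ {n} r s)))       ≈⟨ frob-cong (toℕ i) orbit ⟩
        frob (toℕ i) (E (ρ {n} (_⊖_ {n} r s)))        ≡⟨ cong (λ d → frob (toℕ i) (E d)) rep≡ ⟨
        frob (toℕ i) (E (rep t e))                    ≈⟨ E-double (rep t e) (toℕ i) ⟨
        E (shift t e i)                               ∎)
    ...     | i′ , eq = i′ , r , s , r∈ , s∈ , eq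

    realised : ∀ d → ¬ (E d ≈ 1#) → ∃[ t ] ∃[ i ] Realises d t i
    realised d Ed≉1 = let (t , e , i) , eq = shift³-onto d Ed≉1 in
      t , subst (λ d → ∃[ i′ ] Realises d t i′) eq (shift-realised t e i)

    -- Equality with a block is taken as `≐ˢ`, so that extensional invariance is built in.
    blocks : Pred (Subspace n) 0ℓ
    blocks Y = ∃[ t ] ∃[ j ] ∃[ i ] Y ≐ˢ block (X t) j i

    pair-covered : ∀ {u v} → u ≢ 𝟎 → v ≢ 𝟎 → u ≢ v →
      ∃[ t ] ∃[ j ] ∃[ i ] u ∈ carrier (block (X t) j i) × v ∈ carrier (block (X t) j i)
    pair-covered {u} {v} u≢𝟎 v≢𝟎 u≢v =
      let d , Ed≉1 , Ed*v≈u                     = ratio u≢𝟎 v≢𝟎 u≢v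
          t , i , r , s , r∈ , s∈ , frob-d≈     = realised d Ed≉1
          -- This `j` is chosen to carry the Frobenius image of `v` to `E s`; that of `u` then lands
          -- on `E r`, since the quotients agree.
          j , j*v≈s                             = divide (E-nonzero s) (^-nonzero (to-nonzero v≢𝟎) (2 ^ toℕ i))
      in t , j , i ,
      subst (carrier (X t)) (from-cong (begin
        E r                                                            ≈⟨ E-⊖ r s ⟨
        E (_⊖_ {n} r s) *ᶠ E s                                         ≈⟨ *-cong frob-d≈ j*v≈s ⟨
        frob (toℕ i) (E d) *ᶠ (E j *ᶠ frob (toℕ i) (to v))             ≈⟨ twist-ratio {d} j (toℕ i) Ed*v≈u ⟩
        E j *ᶠ frob (toℕ i) (to u)                                     ∎)) r∈ ,
      subst (carrier (X t)) (from-cong (≈-sym j*v≈s)) s∈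

    -- Both differences lie in the coset of `d`, so their representatives coincide. Once `t`,
    -- `(r , s)` and `i` are identified, the equation for `E r` determines `E j`, because `x` is
    -- nonzero.
    quotient-determines-block : ∀ {x y d} → ¬ (x ≈ 0#) → ¬ (E d ≈ 1#) → E d *ᶠ y ≈ x →
      ∀ {t t′ j j′ i i′ r s r′ s′} →
      r ∈ exponents (X t) → E r ≈ E j *ᶠ frob (toℕ i) x →
      s ∈ exponents (X t) → E s ≈ E j *ᶠ frob (toℕ i) y →
      r′ ∈ exponents (X t′) → E r′ ≈ E j′ *ᶠ frob (toℕ i′) x →
      s′ ∈ exponents (X t′) → E s′ ≈ E j′ *ᶠ frob (toℕ i′) y →
      t ≡ t′ × j ≡ j′ × i ≡ i′
    quotient-determines-block {x} {y} {d} x≉0 Ed≉1 d*y≈x {t} {t′} {j} {j′} {i} {i′} {r} {s} {r′} {s′}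
      r∈ Er≈ s∈ Es≈ r′∈ Er′≈ s′∈ Es′≈ = t≡t′ , j≡j′ , i≡i′
      where
      δ = _⊖_ {n} r s
      δ′ = _⊖_ {n} r′ s′
      frob-d : frob (toℕ i) (E d) ≈ E δ
      frob-d = frob-ratio {d} {r} {s} j (toℕ i) d*y≈x Er≈ Es≈
      frob-d′ : frob (toℕ i′) (E d) ≈ E δ′
      frob-d′ = frob-ratio {d} {r′} {s′} j′ (toℕ i′) d*y≈x Er′≈ Es′≈
      r≢s : r ≢ s
      r≢s = E-⊖-≉1⇒≢ (frob-≉1 (toℕ i) Ed≉1 ∘ ≈-trans frob-d)
      r′≢s′ : r′ ≢ s′
      r′≢s′ = E-⊖-≉1⇒≢ (frob-≉1 (toℕ i′) Ed≉1 ∘ ≈-trans frob-d′)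
      ρδ≡ρδ′ : ρ {n} δ ≡ ρ {n} δ′
      ρδ≡ρδ′ = trans (sym (ρ-invariant (toℕ i) d δ frob-d)) (ρ-invariant (toℕ i′) d δ′ frob-d′)
      t≡t′ : t ≡ t′
      t≡t′ = ρΔ-index (r , s , r∈ , s∈ , r≢s , refl) (r′ , s′ , r′∈ , s′∈ , r′≢s′ , ρδ≡ρδ′)
      rs≡ : (r , s) ≡ (r′ , s′)
      rs≡ = difference-injective (X-dim t) (complete t) r∈ s∈ r≢s
        -- Coset completeness concerns a single subspace, so the second pair is first moved from
        -- `X t′` to `X t`.
        (subst (λ t → r′ ∈ exponents (X t)) (sym t≡t′) r′∈)
        (subst (λ t → s′ ∈ exponents (X t)) (sym t≡t′) s′∈) r′≢s′ ρδ≡ρδ′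
      i≡i′ : i ≡ i′
      i≡i′ = Fin.toℕ-injective (frob-distinct n-prime (E-nonzero d) Ed≉1 (Fin.toℕ<n i) (Fin.toℕ<n i′) (begin
        frob (toℕ i) (E d)                           ≈⟨ frob-d ⟩
        E δ                                          ≡⟨ cong (λ p → E (_⊖_ {n} (proj₁ p) (proj₂ p))) rs≡ ⟩
        E δ′                                         ≈⟨ frob-d′ ⟨
        frob (toℕ i′) (E d)                          ∎))
      j≡j′ : j ≡ j′
      j≡j′ = E-injective j j′ (*-cancelʳ (^-nonzero x≉0 (2 ^ toℕ i)) (begin
        E j *ᶠ frob (toℕ i) x                   ≈⟨ Er≈ ⟨
        E r                                          ≡⟨ cong (λ p → E (proj₁ p)) rs≡ ⟩
        E r′                                         ≈⟨ Er′≈ ⟩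
        E j′ *ᶠ frob (toℕ i′) x                 ≡⟨ cong (λ i → E j′ *ᶠ frob (toℕ i) x) i≡i′ ⟨
        E j′ *ᶠ frob (toℕ i) x                  ∎))

    pair-covered-once : ∀ {u v} → u ≢ 𝟎 → v ≢ 𝟎 → u ≢ v → ∀ {t t′ j j′ i i′} →
      u ∈ carrier (block (X t) j i) → v ∈ carrier (block (X t) j i) →
      u ∈ carrier (block (X t′) j′ i′) → v ∈ carrier (block (X t′) j′ i′) →
      t ≡ t′ × j ≡ j′ × i ≡ i′
    pair-covered-once u≢𝟎 v≢𝟎 u≢v {t} {t′} {j} {j′} {i} {i′} u∈ v∈ u∈′ v∈′ =
      let d  , Ed≉1 , d*v≈u = ratio u≢𝟎 v≢𝟎 u≢v
          r  , r∈  , Er≈    = block-exponent {X t} j i u≢𝟎 u∈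
          s  , s∈  , Es≈    = block-exponent {X t} j i v≢𝟎 v∈
          r′ , r′∈ , Er′≈   = block-exponent {X t′} j′ i′ u≢𝟎 u∈′
          s′ , s′∈ , Es′≈   = block-exponent {X t′} j′ i′ v≢𝟎 v∈′
      in quotient-determines-block {d = d} (to-nonzero u≢𝟎) Ed≉1 d*v≈u {t} {t′} {j} {j′} {i} {i′} {r} {s} {r′} {s′}
           r∈ Er≈ s∈ Es≈ r′∈ Er′≈ s′∈ Es′≈

    block-reflexive : ∀ {t t′ j j′ i i′} → t ≡ t′ × j ≡ j′ × i ≡ i′ → block (X t) j i ≐ˢ block (X t′) j′ i′
    block-reflexive (refl , refl , refl) = id , id

    -- The exact covering of 2-dimensional subspaces.

    steiner : SteinerStructure k n
    steiner = record
      { blocks      = blocks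
      ; blocks-resp = λ {Y} {Z} Y≐Z → λ (t , j , i , Y≐) →
          t , j , i , ≐ˢ-trans Z Y (block (X t) j i) (≐ˢ-sym Y Z Y≐Z) Y≐
      ; blocks-dim  = λ {Y} → λ (t , j , i , Y≐) →
          HasDimension-resp (block (X t) j i) Y (≐ˢ-sym Y (block (X t) j i) Y≐) (block-dimension (X-dim t) j i)
      ; covering    = covering
      }
      where
      -- A block contains `T` once it contains the basis `u`, `v`. Conversely, every block
      -- containing `T` contains this pair, so uniqueness for pairs suffices.
      module Cover (T : Subspace n) {u v : 𝔽₂^ n} (basis : IsBasis T (u ∷ v ∷ []))
                   {t j i} (u∈ : u ∈ carrier (block (X t) j i)) (v∈ : v ∈ carrier (block (X t) j i)) where
        open IsBasis basis

        contained : T ⊆ˢ block (X t) j i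
        contained w∈ with spanning w∈
        ... | bs , refl = linearCombination-mem (block (X t) j i) (u∈ VecAll.∷ v∈ VecAll.∷ VecAll.[]) bs

        unique : ∀ {Y} → Y ∈ blocks × T ⊆ˢ Y → block (X t) j i ≐ˢ Y
        unique {Y} ((t′ , j′ , i′ , Y≐) , T⊆Y) with basis-distinct {T = T} basis | members
        ... | u≢𝟎 , v≢𝟎 , u≢v | u∈T VecAll.∷ v∈T VecAll.∷ VecAll.[] =
          ≐ˢ-trans (block (X t) j i) (block (X t′) j′ i′) Y
            (block-reflexive (pair-covered-once u≢𝟎 v≢𝟎 u≢v {t} {t′} {j} {j′} {i} {i′} u∈ v∈
              (proj₁ Y≐ (T⊆Y u∈T)) (proj₁ Y≐ (T⊆Y v∈T))))
            (≐ˢ-sym Y (block (X t′) j′ i′) Y≐)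

      covering : ∀ T → HasDimension T 2 → ∃! _≐ˢ_ (λ Y → Y ∈ blocks × T ⊆ˢ Y)
      covering T (u ∷ v ∷ [] , basis) =
        let u≢𝟎 , v≢𝟎 , u≢v       = basis-distinct {T = T} basis
            t , j , i , u∈ , v∈   = pair-covered u≢𝟎 v≢𝟎 u≢v
        in block (X t) j i , ((t , j , i , id , id) , Cover.contained T basis {t} {j} {i} u∈ v∈) ,
           λ {Y} → Cover.unique T basis {t} {j} {i} u∈ v∈ {Y}

theorem2 : ∀ {c ℓ} (n : ℕ) (n-prime : Prime n)
    (F : CommutativeRing c ℓ) → IsField F → HasOrder F (2 ^ n) →
    (α : CommutativeRing.Carrier F) → IsPrimitive F α →
    (φ : Identification F n) →
    (k : ℕ) → 2 ≤ k →
    let open CosetDifferences {{prime⇒nonZero n-prime}} F φ α in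
    (N : ℕ) → N * ((2 ^ k ∸ 1) * (2 ^ k ∸ 2) * n) ≡ 2 ^ n ∸ 2 →
    (X : Fin N → Subspace n) →
    (∀ i → HasDimension (X i) k) →
    (∀ i → CosetComplete k (X i)) →
    (∀ i j → i ≢ j → Disjoint (X i) (X j)) →
    SteinerStructure k n
theorem2 n n-prime F F-field order α α-primitive φ k _ N count X X-dim complete disjoint =
  Cyclotomy.steiner n {{prime⇒nonZero n-prime}} n-prime F F-field order α α-primitive φ count X X-dim complete disjoint
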